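{- For every integer $k\ge 1$, every $k$-connected graph $G$ with $\delta(G)\ge 2k+1$ contains a $k$-removable $\bigl\lceil(\delta(G)+1)/2\bigr\rceil$-matching, unless $\delta(G)$ is even and $G\cong K_{\delta(G)+1}$.
   Context: All graphs are finite, undirected and simple. $\delta(G)$ denotes the minimum degree of $G$, and $K_n$ is the complete graph on $n$ vertices. A graph is $k$-connected if it has at least $k+1$ vertices and deleting any set of at most $k-1$ vertices leaves a connected graph. For $F\subseteq E(G)$, $G-F$ is the graph obtained from $G$ by deleting the edges in $F$ (keeping all vertices). A matching is a set of pairwise disjoint edges; an $\ell$-matching is a matching consisting of exactly $\ell$ edges. A matching $M$ of a $k$-connected graph $G$ is $k$-removable if $G-M$ is $k$-connected. -}

module Defs where

open import Data.Fin.Base using (Fin)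
open import Data.Fin.Properties using (_≟_)
open import Data.Fin.Subset using (Subset; _∉_; ∣_∣)
open import Data.List.Base using (List; length; map; filter; allFin)
open import Data.List.Extrema.Nat using (min)
open import Data.List.Relation.Unary.Any using (Any; any?)
import Data.List.Relation.Unary.Any as Any
open import Data.List.Relation.Unary.AllPairs using (AllPairs)
open import Data.Nat.Base using (ℕ; _<_)
open import Data.Product.Base using (_×_; _,_; Σ-syntax; proj₁; proj₂)
open import Data.Sum.Base using (_⊎_; swap)
open import Function.Base using (_∘_)
open import Function.Bundles using (_↔_; _⇔_; Inverse)
open import Level using (0ℓ)
open import Relation.Binary.Core using (Rel)
open import Relation.Binary.Construct.Closure.ReflexiveTransitive using (Star)
open import Relation.Binary.Definitions using (Decidable; Symmetric)
open import Relation.Binary.PropositionalEquality using (_≡_; _≢_; refl; ≢-sym)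
open import Relation.Nullary.Decidable using (Dec; ¬?; _×-dec_; _⊎-dec_)
open import Relation.Nullary.Negation using (¬_)

-- Finite simple graphs on the vertex set Fin n.
record Graph (n : ℕ) : Set₁ where
  field
    Adj    : Rel (Fin n) 0ℓ
    adj?   : Decidable Adj
    sym    : Symmetric Adj
    irrefl : ∀ {v} → ¬ Adj v v

open Graph public

degree : ∀ {n} → Graph n → Fin n → ℕ
degree {n} G v = length (filter (adj? G v) (allFin n))

-- The first argument of min is included in the minimum.  Every degree is less
-- than n, so for n ≥ 1 this is the minimum degree; the empty graph gets 0.
δ : ∀ {n} → Graph n → ℕ
δ {n} G = min n (map (degree G) (allFin n))

K : (n : ℕ) → Graph n
K n = record
  { Adj    = _≢_
  ; adj?   = λ u v → ¬? (u ≟ v)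
  ; sym    = ≢-sym
  ; irrefl = λ v≢v → v≢v refl
  }

infix 4 _≅_

_≅_ : ∀ {m n} → Graph m → Graph n → Set
_≅_ {m} {n} G H =
  Σ[ f ∈ Fin m ↔ Fin n ]
    (∀ u v → Adj G u v ⇔ Adj H (Inverse.to f u) (Inverse.to f v))

-- G with the vertices in S deleted is connected: any two vertices outside S
-- are joined by a walk of G all of whose vertices are outside S.
ConnectedWithout : ∀ {n} → Graph n → Subset n → Set
ConnectedWithout G S =
  ∀ u v → u ∉ S → v ∉ S →
  Star (λ x y → x ∉ S × y ∉ S × Adj G x y) u v

-- "At least k + 1 vertices" is k < n, and "at most k - 1 vertices" is
-- ∣ S ∣ < k, which avoids truncated subtraction.
Connected[_] : ℕ → ∀ {n} → Graph n → Set
Connected[ k ] {n} G =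
  k < n × (∀ (S : Subset n) → ∣ S ∣ < k → ConnectedWithout G S)

-- An edge is given by its two ends in either order; (u , v) and (v , u)
-- represent the same edge, and Joins identifies them.
Edge : ∀ {n} → Graph n → Set
Edge {n} G = Σ[ (u , v) ∈ Fin n × Fin n ] Adj G u v

module _ {n : ℕ} {G : Graph n} where

  end₁ end₂ : Edge G → Fin n
  end₁ = proj₁ ∘ proj₁
  end₂ = proj₂ ∘ proj₁

  Joins : Fin n → Fin n → Edge G → Set
  Joins u v e = (end₁ e ≡ u × end₂ e ≡ v) ⊎ (end₁ e ≡ v × end₂ e ≡ u)

  joins? : ∀ u v (e : Edge G) → Dec (Joins u v e)
  joins? u v e =
    (end₁ e ≟ u ×-dec end₂ e ≟ v) ⊎-dec (end₁ e ≟ v ×-dec end₂ e ≟ u)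

  Disjoint : Edge G → Edge G → Set
  Disjoint e f =
    end₁ e ≢ end₁ f × end₁ e ≢ end₂ f × end₂ e ≢ end₁ f × end₂ e ≢ end₂ f

infixl 6 _-ᴱ_

-- A set F ⊆ E(G) is given by a list of edges of G.
_-ᴱ_ : ∀ {n} (G : Graph n) → List (Edge G) → Graph n
G -ᴱ F = record
  { Adj    = λ u v → Adj G u v × ¬ Any (Joins {G = G} u v) F
  ; adj?   = λ u v → adj? G u v ×-dec ¬? (any? (joins? {G = G} u v) F)
  ; sym    = λ (uv , uv∉F) → sym G uv , uv∉F ∘ Any.map swap
  ; irrefl = irrefl G ∘ proj₁
  }

-- Pairwise disjointness excludes repeated edges, so the number of edges of a
-- matching is the length of the list.
Matching[_] : ℕ → ∀ {n} (G : Graph n) → List (Edge G) → Set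
Matching[ ℓ ] G M = AllPairs (Disjoint {G = G}) M × length M ≡ ℓ

Removable[_] : ℕ → ∀ {n} (G : Graph n) → List (Edge G) → Set
Removable[ k ] G M = Connected[ k ] (G -ᴱ M)

{-# OPTIONS --safe #-}
module Submission where

-- A k-removable matching M with 2∣M∣ ≤ δ is enlarged by one edge.  Let U be the
-- set of uncovered vertices and H = G − M.  If no edge inside U can be added
-- to M, each of them is essential in H, and since all degrees in U exceed k,
-- Mader's argument (a walk along essential edges meets ever smaller sides of
-- cuts) shows that every nonempty W ⊆ U has a vertex with at most one neighbour
-- in W.  This yields u, v ∈ U with at least δ − 1 covered neighbours each; they
-- are not adjacent, as an essential edge has fewer than k common neighbours.  By
-- counting, some xy ∈ M has ux, vy ∈ E(G), and M′ = M − xy + ux + vy is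
-- removable.  Indeed, suppose that G − M′ has a cut with u on one side.  The
-- other side does not contain v, because of the common neighbours of u and v and
-- the path u y x v, so it has at most 2∣M∣ − δ + 2 covered vertices, too few for
-- the degree of a leaf of its uncovered part.  The same holds for v.  Hence u and
-- v lie in the separator, which then separates H as well.  The process can only
-- get stuck when ∣U∣ ≤ 1, which forces G to be complete with δ even.

open import Defs
open import Algebra.Properties.CommutativeSemigroup using (interchange)
open import Data.Bool.Base using (true; false; if_then_else_)
open import Data.Empty using (⊥; ⊥-elim)
open import Data.Fin.Base using (Fin; zero; suc; fromℕ<)
open import Data.Fin.Properties using (_≟_; any?)
open import Data.Fin.Subset using (Subset; _∈_; _∉_; ∣_∣; inside; outside)
open import Data.Fin.Subset.Properties using (_∈?_)
open import Data.List.Base using (List; []; _∷_; _++_; length; map; filter; allFin)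
import Data.List.Base as List
open import Data.List.Extrema.Nat using (min≤xs)
open import Data.List.Membership.Propositional using (find)
open import Data.List.Membership.Propositional.Properties using (∈-∃++; ∈-map⁺; ∈-allFin)
open import Data.List.Relation.Binary.Permutation.Propositional using (_↭_; ↭-sym; ↭⇒↭ₛ)
open import Data.List.Relation.Binary.Permutation.Propositional.Properties
  using (shift; Any-resp-↭; ↭-length)
import Data.List.Relation.Binary.Permutation.Setoid.Properties as Permutationₛ
open import Data.List.Relation.Unary.All using (All; []; _∷_)
import Data.List.Relation.Unary.All as All
open import Data.List.Relation.Unary.All.Properties using (¬Any⇒All¬)
open import Data.List.Relation.Unary.AllPairs using (AllPairs; []; _∷_)
import Data.List.Relation.Unary.AllPairs as AllPairs
open import Data.List.Relation.Unary.Any using (Any; here; there)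
import Data.List.Relation.Unary.Any as Any
open import Data.Nat.Base
open import Data.Nat.Divisibility using (_∣_; divides)
open import Data.Nat.Properties hiding (_≟_)
open import Data.Nat.Tactic.RingSolver using (solve-∀)
open import Data.Product.Base using (_×_; _,_; Σ-syntax; ∃-syntax; proj₁; proj₂)
open import Data.Sum.Base using (_⊎_; inj₁; inj₂; [_,_]′)
import Data.Sum.Base as Sum
open import Data.Unit.Base using (tt)
open import Data.Vec.Base using ([]; _∷_; here; there; tabulate)
open import Data.Vec.Properties using (lookup⇒[]=; []=⇒lookup; lookup∘tabulate)
open import Function.Base using (_∘_; id)
open import Function.Bundles using (mk⇔)
open import Function.Construct.Identity using (↔-id)
open import Level using (0ℓ)
open import Relation.Binary.Construct.Closure.ReflexiveTransitive using (Star; ε; _◅_; _◅◅_)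
import Relation.Binary.Construct.Closure.ReflexiveTransitive as Star
open import Relation.Binary.PropositionalEquality hiding (sym)
import Relation.Binary.PropositionalEquality as ≡
open import Relation.Nullary.Decidable hiding (map)
open import Relation.Nullary.Negation using (¬_; contradiction)
open import Relation.Unary using (Pred; Decidable)
open import Relation.Unary.Properties using (∅?) renaming (U? to ⊤?)

private variable
  n k : ℕ

-- Exhaustive search over indices and subsets

all⊎ : ∀ {A : Set} {P : Fin n → Set} → (∀ i → A ⊎ P i) → A ⊎ (∀ i → P i)
all⊎ {zero}  f = inj₂ λ ()
all⊎ {suc n} f with f zero | all⊎ (f ∘ suc)
... | inj₁ a | _      = inj₁ a
... | inj₂ _ | inj₁ a = inj₁ a
... | inj₂ q | inj₂ g = inj₂ λ { zero → q ; (suc i) → g i }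

-- This replaces a decision procedure for connectivity: trying every separator either produces a
-- concrete cut or collects a proof for each set.
allSubsets⊎ : ∀ {A : Set} {Q : Subset n → Set} → (∀ S → A ⊎ Q S) → A ⊎ (∀ S → Q S)
allSubsets⊎ {zero}  f = Sum.map₂ (λ { q [] → q }) (f [])
allSubsets⊎ {suc n} f with allSubsets⊎ (f ∘ (inside ∷_)) | allSubsets⊎ (f ∘ (outside ∷_))
... | inj₁ a | _      = inj₁ a
... | inj₂ _ | inj₁ a = inj₁ a
... | inj₂ g | inj₂ h = inj₂ λ { (true ∷ S) → g S ; (false ∷ S) → h S }

-- Counting elements of decidable subsets of Fin n

⟦_⟧ : {A : Set} → Dec A → ℕ
⟦ a? ⟧ = if does a? then 1 else 0

-- Neighbourhoods, sides of cuts and covered sets are all decidable predicates, so they are counted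
-- directly; `degree≡#` and `∣∣≡#` link this count to degrees and to sizes of subsets.
# : {P : Pred (Fin n) 0ℓ} → Decidable P → ℕ
# {zero}  P? = 0
# {suc n} P? = ⟦ P? zero ⟧ + # (P? ∘ suc)

-- Summed over all elements, this becomes the counting inequality from which the later ones are
-- drawn: with the second set on the left empty it is the union bound, with the last set on the
-- right empty the bound for disjoint sets.
⟦⟧-modular : ∀ {A B C D : Set} (a? : Dec A) (b? : Dec B) (c? : Dec C) (d? : Dec D) →
             (A → C ⊎ D) → (B → C ⊎ D) → (A → B → C × D) →
             ⟦ a? ⟧ + ⟦ b? ⟧ ≤ ⟦ c? ⟧ + ⟦ d? ⟧
⟦⟧-modular a? b? c? d? f g h with a? | b? | c? | d?
... | no _  | no _  | _     | _     = z≤n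
... | yes _ | no _  | yes _ | _     = s≤s z≤n
... | yes _ | no _  | no _  | yes _ = s≤s z≤n
... | yes a | no _  | no ¬c | no ¬d = ⊥-elim ([ ¬c , ¬d ]′ (f a))
... | no _  | yes _ | yes _ | _     = s≤s z≤n
... | no _  | yes _ | no _  | yes _ = s≤s z≤n
... | no _  | yes b | no ¬c | no ¬d = ⊥-elim ([ ¬c , ¬d ]′ (g b))
... | yes _ | yes _ | yes _ | yes _ = ≤-refl
... | yes a | yes b | no ¬c | _     = ⊥-elim (¬c (proj₁ (h a b)))
... | yes a | yes b | yes _ | no ¬d = ⊥-elim (¬d (proj₂ (h a b)))

#-modular : {P Q R S : Pred (Fin n) 0ℓ}
            (P? : Decidable P) (Q? : Decidable Q) (R? : Decidable R) (S? : Decidable S) →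
            (∀ {i} → P i → R i ⊎ S i) → (∀ {i} → Q i → R i ⊎ S i) →
            (∀ {i} → P i → Q i → R i × S i) →
            # P? + # Q? ≤ # R? + # S?
#-modular {zero}  P? Q? R? S? f g h = z≤n
#-modular {suc n} P? Q? R? S? f g h = begin
  (⟦ P? zero ⟧ + # (P? ∘ suc)) + (⟦ Q? zero ⟧ + # (Q? ∘ suc))
    ≡⟨ interchange +-commutativeSemigroup ⟦ P? zero ⟧ _ _ _ ⟩
  (⟦ P? zero ⟧ + ⟦ Q? zero ⟧) + (# (P? ∘ suc) + # (Q? ∘ suc))
    ≤⟨ +-mono-≤ (⟦⟧-modular (P? zero) (Q? zero) (R? zero) (S? zero) f g h)
                (#-modular (P? ∘ suc) (Q? ∘ suc) (R? ∘ suc) (S? ∘ suc) f g h) ⟩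
  (⟦ R? zero ⟧ + ⟦ S? zero ⟧) + (# (R? ∘ suc) + # (S? ∘ suc))
    ≡⟨ interchange +-commutativeSemigroup ⟦ R? zero ⟧ _ _ _ ⟩
  (⟦ R? zero ⟧ + # (R? ∘ suc)) + (⟦ S? zero ⟧ + # (S? ∘ suc)) ∎
  where open ≤-Reasoning

#-∅ : {P : Pred (Fin n) 0ℓ} (P? : Decidable P) → (∀ i → ¬ P i) → # P? ≡ 0
#-∅ {zero}  P? ∅ = refl
#-∅ {suc n} P? ∅ with P? zero
... | yes p = ⊥-elim (∅ zero p)
... | no _  = #-∅ (P? ∘ suc) (∅ ∘ suc)

#-∪ : {P Q T : Pred (Fin n) 0ℓ}
      (P? : Decidable P) (Q? : Decidable Q) (T? : Decidable T) →
      (∀ {i} → P i → Q i ⊎ T i) → # P? ≤ # Q? + # T?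
#-∪ {n = n} P? Q? T? f = begin
  # P?             ≡⟨ +-identityʳ _ ⟨
  # P? + 0         ≡⟨ cong (# P? +_) (#-∅ {n} ∅? λ _ → id) ⟨
  # P? + # {n} ∅?  ≤⟨ #-modular P? ∅? Q? T? f (λ ()) (λ _ ()) ⟩
  # Q? + # T?      ∎
  where open ≤-Reasoning

#-disjoint : {P Q T : Pred (Fin n) 0ℓ}
             (P? : Decidable P) (Q? : Decidable Q) (T? : Decidable T) →
             (∀ {i} → P i → T i) → (∀ {i} → Q i → T i) → (∀ {i} → P i → ¬ Q i) →
             # P? + # Q? ≤ # T?
#-disjoint {n = n} P? Q? T? f g h = begin
  # P? + # Q?      ≤⟨ #-modular P? Q? T? ∅? (inj₁ ∘ f) (inj₁ ∘ g) (λ p q → ⊥-elim (h p q)) ⟩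
  # T? + # {n} ∅?  ≡⟨ cong (# T? +_) (#-∅ {n} ∅? λ _ → id) ⟩
  # T? + 0         ≡⟨ +-identityʳ _ ⟩
  # T?             ∎
  where open ≤-Reasoning

#-mono : {P Q : Pred (Fin n) 0ℓ}
         (P? : Decidable P) (Q? : Decidable Q) → (∀ {i} → P i → Q i) → # P? ≤ # Q?
#-mono {n = n} P? Q? f = ≤-trans (m≤m+n _ _) (#-disjoint P? ∅? Q? f (λ ()) (λ _ ()))

#-singleton : (a : Fin n) → # (_≟ a) ≡ 1
#-singleton {suc n} zero = cong suc (#-∅ {n} (λ i → suc i ≟ zero) λ _ ())
#-singleton {suc n} (suc a) = ≤-antisym
  (≤-trans (#-mono (λ i → suc i ≟ suc a) (_≟ a) λ { refl → refl }) (≤-reflexive (#-singleton a)))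
  (≤-trans (≤-reflexive (≡.sym (#-singleton a))) (#-mono (_≟ a) (λ i → suc i ≟ suc a) λ { refl → refl }))

#-strict : {P Q : Pred (Fin n) 0ℓ}
           (P? : Decidable P) (Q? : Decidable Q) → (∀ {i} → P i → Q i) →
           ∀ {a} → Q a → ¬ P a → # P? < # Q?
#-strict P? Q? f {a} qa ¬pa = begin
  suc (# P?)         ≡⟨ +-comm 1 _ ⟩
  # P? + 1           ≡⟨ cong (# P? +_) (#-singleton a) ⟨
  # P? + # (_≟ a)    ≤⟨ #-disjoint P? (_≟ a) Q? f (λ { refl → qa }) (λ { p refl → ¬pa p }) ⟩
  # Q?               ∎
  where open ≤-Reasoning

#-insert : {P Q : Pred (Fin n) 0ℓ}
           (P? : Decidable P) (Q? : Decidable Q) (a : Fin n) →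
           (∀ {i} → P i → Q i ⊎ i ≡ a) → # P? ≤ suc (# Q?)
#-insert P? Q? a f = begin
  # P?             ≤⟨ #-∪ P? Q? (_≟ a) f ⟩
  # Q? + # (_≟ a)  ≡⟨ cong (# Q? +_) (#-singleton a) ⟩
  # Q? + 1         ≡⟨ +-comm _ 1 ⟩
  suc (# Q?)       ∎
  where open ≤-Reasoning

#-⊤ : {P : Pred (Fin n) 0ℓ} (P? : Decidable P) → (∀ i → P i) → # P? ≡ n
#-⊤ {zero}  P? ⊤ = refl
#-⊤ {suc n} P? ⊤ with P? zero
... | yes _ = cong suc (#-⊤ (P? ∘ suc) (⊤ ∘ suc))
... | no ¬p = ⊥-elim (¬p (⊤ zero))

#≤n : {P : Pred (Fin n) 0ℓ} (P? : Decidable P) → # P? ≤ n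
#≤n {n} P? = ≤-trans (#-mono P? ⊤? _) (≤-reflexive (#-⊤ {n} ⊤? _))

#-filter-tabulate : ∀ {m} {P : Pred (Fin m) 0ℓ} (P? : Decidable P) (f : Fin n → Fin m) →
                    length (filter P? (List.tabulate f)) ≡ # (P? ∘ f)
#-filter-tabulate {zero}  P? f = refl
#-filter-tabulate {suc n} P? f with P? (f zero)
... | yes _ = cong suc (#-filter-tabulate P? (f ∘ suc))
... | no _  = #-filter-tabulate P? (f ∘ suc)

degree≡# : (G : Graph n) (v : Fin n) → degree G v ≡ # (adj? G v)
degree≡# G v = #-filter-tabulate (adj? G v) id

∣∣≡# : (S : Subset n) → ∣ S ∣ ≡ # (_∈? S)
∣∣≡# []      = refl
∣∣≡# (b ∷ S) with b | ≤-antisym (#-mono (_∈? S) (λ i → suc i ∈? (b ∷ S)) there)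
                                (#-mono (λ i → suc i ∈? (b ∷ S)) (_∈? S) λ { (there p) → p })
... | true  | eq = cong suc (trans (∣∣≡# S) eq)
... | false | eq = trans (∣∣≡# S) eq

-- Cuts

-- C is the separator, L and R are the two sides of a cut.
data Side : Set where
  L C R : Side

_≟ˢ_ : (s t : Side) → Dec (s ≡ t)
L ≟ˢ L = yes refl
L ≟ˢ C = no λ ()
L ≟ˢ R = no λ ()
C ≟ˢ L = no λ ()
C ≟ˢ C = yes refl
C ≟ˢ R = no λ ()
R ≟ˢ L = no λ ()
R ≟ˢ C = no λ ()
R ≟ˢ R = yes refl

flip : Side → Side
flip L = R
flip C = C
flip R = L

flip-involutive : ∀ s → flip (flip s) ≡ s
flip-involutive L = refl
flip-involutive C = refl
flip-involutive R = refl

flip-swap : ∀ {s t} → flip s ≡ t → s ≡ flip t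
flip-swap {s} refl = ≡.sym (flip-involutive s)

on : (σ : Fin n → Side) (s : Side) → Decidable (λ i → σ i ≡ s)
on σ s i = σ i ≟ˢ s

Separates : (Fin n → Side) → Graph n → Set
Separates σ H = ∀ {p q} → Adj H p q → σ p ≡ L → σ q ≡ R → ⊥

record Cut (k : ℕ) (H : Graph n) : Set where
  constructor cut
  field
    side         : Fin n → Side
    small        : # (on side C) < k
    separates    : Separates side H
    {left right} : Fin n
    left∈L       : side left ≡ L
    right∈R      : side right ≡ R

separates-flip : (H : Graph n) {σ : Fin n → Side} → Separates σ H → Separates (flip ∘ σ) H
separates-flip H sep pq p∈ q∈ = sep (sym H pq) (flip-swap q∈) (flip-swap p∈)

#-flip : (σ : Fin n → Side) → # (on (flip ∘ σ) C) ≤ # (on σ C)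
#-flip σ = #-mono (on (flip ∘ σ) C) (on σ C) flip-swap

flipCut : {H : Graph n} → Cut k H → Cut k H
flipCut {H = H} c = cut (flip ∘ side) (≤-<-trans (#-flip side) small) (separates-flip H separates)
                (cong flip right∈R) (cong flip left∈L)
  where open Cut c

-- A walk from the left to the right side that avoids the separator would need an edge directly from
-- `L` to `R`.
connected⇒¬cut : {H : Graph n} → Connected[ k ] H → ¬ Cut k H
connected⇒¬cut {n} {k} {H} (_ , conn) (cut σ small sep {l} {r} l∈L r∈R) =
  contradiction (trans (≡.sym r∈R) (walk l∈L (conn Z ∣Z∣<k l r (∉Z l∈L λ ()) (∉Z r∈R λ ())))) λ ()
  where
  Z : Subset n
  Z = tabulate (λ i → does (on σ C i))

  Z⊆C : ∀ {i} → i ∈ Z → σ i ≡ C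
  Z⊆C {i} i∈Z with on σ C i | trans (≡.sym (lookup∘tabulate (λ i → does (on σ C i)) i)) ([]=⇒lookup i∈Z)
  ... | yes p | _ = p
  ... | no _  | ()

  C⊆Z : ∀ {i} → σ i ≡ C → i ∈ Z
  C⊆Z {i} i∈C = lookup⇒[]= i Z (trans (lookup∘tabulate (λ i → does (on σ C i)) i) (dec-true (on σ C i) i∈C))

  ∉Z : ∀ {i s} → σ i ≡ s → s ≢ C → i ∉ Z
  ∉Z refl s≢C i∈Z = s≢C (Z⊆C i∈Z)

  ∣Z∣<k : ∣ Z ∣ < k
  ∣Z∣<k = ≤-<-trans (≤-trans (≤-reflexive (∣∣≡# Z)) (#-mono (_∈? Z) (on σ C) Z⊆C)) small

  walk : ∀ {p q} → σ p ≡ L → Star (λ x y → x ∉ Z × y ∉ Z × Adj H x y) p q → σ q ≡ L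
  walk p∈L ε = p∈L
  walk p∈L (_◅_ {j = y} (_ , y∉Z , xy) w) with σ y in y∈
  ... | L = walk y∈ w
  ... | C = ⊥-elim (y∉Z (C⊆Z y∈))
  ... | R = ⊥-elim (sep xy p∈L y∈)

-- The vertices reached from u form the side L of a colouring that grows until
-- no edge leaves it.
module _ (H : Graph n) (Z : Subset n) {u : Fin n} (u∉Z : u ∉ Z) where

  private
    Step : Fin n → Fin n → Set
    Step x y = x ∉ Z × y ∉ Z × Adj H x y

  record Reach : Set where
    field
      side    : Fin n → Side
      u∈L     : side u ≡ L
      reached : ∀ {i} → side i ≡ L → i ∉ Z × Star Step u i
      C⊆Z     : ∀ {i} → side i ≡ C → i ∈ Z
      Z⊆C     : ∀ {i} → i ∈ Z → side i ≡ C

  start : Reach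
  start = record { side = σ ; u∈L = u∈L ; reached = reached ; C⊆Z = C⊆Z ; Z⊆C = Z⊆C }
    where
    σ : Fin n → Side
    σ i with i ∈? Z | i ≟ u
    ... | yes _ | _     = C
    ... | no _  | yes _ = L
    ... | no _  | no _  = R

    u∈L : σ u ≡ L
    u∈L with u ∈? Z | u ≟ u
    ... | yes u∈Z | _      = ⊥-elim (u∉Z u∈Z)
    ... | no _    | yes _  = refl
    ... | no _    | no u≢u = ⊥-elim (u≢u refl)

    reached : ∀ {i} → σ i ≡ L → i ∉ Z × Star Step u i
    reached {i} eq with i ∈? Z | i ≟ u
    reached {i} () | yes _ | _
    reached {i} () | no _  | no _
    ... | no i∉Z | yes refl = i∉Z , ε

    C⊆Z : ∀ {i} → σ i ≡ C → i ∈ Z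
    C⊆Z {i} eq with i ∈? Z | i ≟ u
    ... | yes i∈Z | _ = i∈Z
    C⊆Z {i} () | no _ | yes _
    C⊆Z {i} () | no _ | no _

    Z⊆C : ∀ {i} → i ∈ Z → σ i ≡ C
    Z⊆C {i} i∈Z with i ∈? Z
    ... | yes _  = refl
    ... | no i∉Z = ⊥-elim (i∉Z i∈Z)

  extend : (r : Reach) → ∀ {p q} → Reach.side r p ≡ L → Reach.side r q ≡ R → Adj H p q →
           Σ[ r′ ∈ Reach ] # (on (Reach.side r′) R) < # (on (Reach.side r) R)
  extend r {p} {q} p∈L q∈R pq =
    record { side = σ ; u∈L = u∈L′ ; reached = reached′ ; C⊆Z = C⊆Z′ ; Z⊆C = Z⊆C′ } ,
    #-strict (on σ R) (on (Reach.side r) R) R⊆R q∈R q∉R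
    where
    open Reach r
    σ : Fin n → Side
    σ i with i ≟ q
    ... | yes _ = L
    ... | no _  = side i

    q∉Z : q ∉ Z
    q∉Z q∈Z = contradiction (trans (≡.sym q∈R) (Z⊆C q∈Z)) λ ()

    u∈L′ : σ u ≡ L
    u∈L′ with u ≟ q
    ... | yes _ = refl
    ... | no _  = u∈L

    reached′ : ∀ {i} → σ i ≡ L → i ∉ Z × Star Step u i
    reached′ {i} eq with i ≟ q
    ... | yes refl = q∉Z , proj₂ (reached p∈L) ◅◅ ((proj₁ (reached p∈L) , q∉Z , pq) ◅ ε)
    ... | no _ = reached eq

    C⊆Z′ : ∀ {i} → σ i ≡ C → i ∈ Z
    C⊆Z′ {i} eq with i ≟ q
    C⊆Z′ {i} () | yes _
    ... | no _ = C⊆Z eq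

    Z⊆C′ : ∀ {i} → i ∈ Z → σ i ≡ C
    Z⊆C′ {i} i∈Z with i ≟ q
    ... | yes refl = ⊥-elim (q∉Z i∈Z)
    ... | no _     = Z⊆C i∈Z

    R⊆R : ∀ {i} → σ i ≡ R → side i ≡ R
    R⊆R {i} eq with i ≟ q
    R⊆R {i} () | yes _
    ... | no _ = eq

    q∉R : σ q ≢ R
    q∉R eq with q ≟ q
    q∉R () | yes _
    ... | no q≢q = q≢q refl

  -- The bound `s` on the vertices still in `R` is the fuel: every extension takes a vertex out of
  -- `R`, and none enters.
  closure : (s : ℕ) (r : Reach) → # (on (Reach.side r) R) ≤ s →
            Σ[ r′ ∈ Reach ] Separates (Reach.side r′) H
  closure s r #R≤s with any? (λ p → any? (λ q →
    on (Reach.side r) L p ×-dec on (Reach.side r) R q ×-dec adj? H p q))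
  ... | no ¬∃ = r , λ pq p∈L q∈R → ¬∃ (_ , _ , p∈L , q∈R , pq)
  ... | yes (_ , _ , p∈L , q∈R , pq) with extend r p∈L q∈R pq
  closure zero    r #R≤s | yes _ | r′ , <s = contradiction (≤-trans <s #R≤s) λ ()
  closure (suc s) r #R≤s | yes _ | r′ , <s = closure s r′ (s≤s⁻¹ (≤-trans <s #R≤s))

  reach⊎cut : ∣ Z ∣ < k → ∀ {v} → v ∉ Z → Cut k H ⊎ Star Step u v
  reach⊎cut ∣Z∣<k {v} v∉Z with closure n start (#≤n _)
  ... | r , sep with Reach.side r v in v∈
  ... | L = inj₂ (proj₂ (Reach.reached r v∈))
  ... | C = ⊥-elim (v∉Z (Reach.C⊆Z r v∈))
  ... | R = inj₁ (cut side (≤-<-trans (≤-trans (#-mono (on side C) (_∈? Z) C⊆Z)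
                                      (≤-reflexive (≡.sym (∣∣≡# Z)))) ∣Z∣<k) sep u∈L v∈)
    where open Reach r

-- Every small `Z` and every pair `u`, `v` outside it is tried; if the closure of `u` misses `v`,
-- then `Z` is the separator of a cut.
cut⊎connected : (H : Graph n) → k < n → Cut k H ⊎ Connected[ k ] H
cut⊎connected {n} {k} H k<n = Sum.map₂ (λ f → k<n , f) (allSubsets⊎ decide)
  where
  decide : ∀ Z → Cut k H ⊎ (∣ Z ∣ < k → ConnectedWithout H Z)
  decide Z with ∣ Z ∣ <? k
  ... | no ≮k  = inj₂ λ <k → contradiction <k ≮k
  ... | yes <k = Sum.map₂ (λ f _ → f) (all⊎ λ u → all⊎ λ v → decideAt u v)
    where
    decideAt : ∀ u v → Cut k H ⊎ (u ∉ Z → v ∉ Z → Star (λ x y → x ∉ Z × y ∉ Z × Adj H x y) u v)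
    decideAt u v with u ∈? Z | v ∈? Z
    ... | yes u∈Z | _       = inj₂ λ u∉Z _ → contradiction u∈Z u∉Z
    ... | no _    | yes v∈Z = inj₂ λ _ v∉Z → contradiction v∈Z v∉Z
    ... | no u∉Z  | no v∉Z  = Sum.map₂ (λ w _ _ → w) (reach⊎cut H Z u∉Z <k v∉Z)

-- Essential edges

-- For an edge ab of a k-connected graph H, a witness that H − ab is not k-connected.
record EssentialCut (k : ℕ) (H : Graph n) (a b : Fin n) : Set where
  constructor essential
  field
    side  : Fin n → Side
    small : # (on side C) < k
    a∈L   : side a ≡ L
    b∈R   : side b ≡ R
    only  : ∀ {p q} → Adj H p q → side p ≡ L → side q ≡ R → p ≡ a × q ≡ b

-- The corner of two crossing cuts: left sides are intersected, right sides united, and what remains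
-- in `C` is the boundary between the corner and the rest.
meet : Side → Side → Side
meet R _ = R
meet L t = t
meet C R = R
meet C _ = C

meet≡L : ∀ s t → meet s t ≡ L → s ≡ L × t ≡ L
meet≡L L L _ = refl , refl
meet≡L C L ()
meet≡L C C ()
meet≡L C R ()

meet≡C : ∀ s t → meet s t ≡ C → s ≡ C ⊎ t ≡ C
meet≡C L C _ = inj₂ refl
meet≡C C L _ = inj₁ refl
meet≡C C C _ = inj₁ refl

meet≡R : ∀ s t → meet s t ≡ R → s ≡ R ⊎ t ≡ R
meet≡R R _ _ = inj₁ refl
meet≡R L R _ = inj₂ refl
meet≡R C R _ = inj₂ refl

meet-R : ∀ s {t} → t ≡ R → meet s t ≡ R
meet-R L refl = refl
meet-R C refl = refl
meet-R R refl = refl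

-- This is the double-counting clause of `submodular`: a vertex on the boundaries of two opposite
-- corners is counted twice there, so it has to be counted by both separators.
opposite-meets≡C : ∀ s t → meet (flip s) t ≡ C → meet s (flip t) ≡ C → s ≡ C × t ≡ C
opposite-meets≡C L L () _
opposite-meets≡C L C () _
opposite-meets≡C L R () _
opposite-meets≡C C L _ ()
opposite-meets≡C C C _ _ = refl , refl
opposite-meets≡C C R () _
opposite-meets≡C R L () _
opposite-meets≡C R C _ ()
opposite-meets≡C R R () _

-- Mader's argument.  The cut σ of ax and the cut τ of xb cross in nine parts.
-- The corner (R , L) contains x, and its boundary has at least as many vertices
-- as the separator of σ, because x has more than k neighbours; submodularity
-- then makes the opposite corner (L , R) empty.
module Crossing {H : Graph n} (conn : Connected[ k ] H) {a x b : Fin n} (a≢b : a ≢ b)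
                (k<deg : k < # (adj? H x))
                (Eσ : EssentialCut k H a x) (Eτ : EssentialCut k H x b) where

  open EssentialCut Eσ renaming (side to σ; small to σ-small; a∈L to a∈L; b∈R to x∈R; only to σ-only)
  open EssentialCut Eτ renaming (side to τ; small to τ-small; a∈L to x∈L; b∈R to b∈R; only to τ-only)

  near far : Fin n → Side
  near i = meet (flip (σ i)) (τ i)
  far  i = meet (σ i) (flip (τ i))

  -- An edge from the corner to its right side crosses one of the two cuts, hence is `xa` or `xb`,
  -- and its end in the corner is `x`.
  near-separates : ∀ {p q} → Adj H p q → near p ≡ L → near q ≡ R → p ≡ x
  near-separates {p} {q} pq p∈ q∈ with meet≡L (flip (σ p)) _ p∈ | meet≡R (flip (σ q)) _ q∈
  ... | p∈R , _ | inj₁ q∈L = proj₂ (σ-only (sym H pq) (flip-swap q∈L) (flip-swap p∈R))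
  ... | _ , p∈L | inj₂ q∈R = proj₁ (τ-only pq p∈L q∈R)

  -- If the corner holds some `y` other than `x`, moving `x` into the boundary yields a cut of `H`
  -- between `y` and `a` whose separator is still smaller than `k`. If it holds only `x`, every
  -- neighbour of `x` is on the boundary or is `a` or `b`, which bounds the degree of `x` by `k`.
  near-boundary : ¬ (2 + # (on near C) ≤ k)
  near-boundary small with any? (λ y → on near L y ×-dec ¬? (y ≟ x))
  ... | yes (y , y∈L , y≢x) = connected⇒¬cut {H = H} conn (cut ρ ρ-small ρ-separates {y} {a} (ρ≢x y∈L y≢x) (ρ≢x a∈R a≢x))
    where
    ρ : Fin n → Side
    ρ i with i ≟ x
    ... | yes _ = C
    ... | no _  = near i

    ρ≢x : ∀ {i s} → near i ≡ s → i ≢ x → ρ i ≡ s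
    ρ≢x {i} eq i≢x with i ≟ x
    ... | yes i≡x = ⊥-elim (i≢x i≡x)
    ... | no _    = eq

    ρ-C : ∀ {i} → ρ i ≡ C → near i ≡ C ⊎ i ≡ x
    ρ-C {i} eq with i ≟ x
    ... | yes i≡x = inj₂ i≡x
    ... | no _    = inj₁ eq

    ρ-near : ∀ {i s} → ρ i ≡ s → s ≢ C → near i ≡ s × i ≢ x
    ρ-near {i} eq s≢C with i ≟ x
    ... | yes _  = ⊥-elim (s≢C (≡.sym eq))
    ... | no i≢x = eq , i≢x

    ρ-small : # (on ρ C) < k
    ρ-small = ≤-trans (s≤s (#-insert (on ρ C) (on near C) x ρ-C)) small

    ρ-separates : Separates ρ H
    ρ-separates pq p∈ q∈ with ρ-near p∈ (λ ()) | ρ-near q∈ (λ ())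
    ... | p∈L , p≢x | q∈R , _ = p≢x (near-separates pq p∈L q∈R)

    a≢x : a ≢ x
    a≢x refl = contradiction (trans (≡.sym a∈L) x∈R) λ ()

    a∈R : near a ≡ R
    a∈R rewrite a∈L = refl
  ... | no ¬∃ = <⇒≱ k<deg (≤-trans deg≤ small)
    where
    neighbour : ∀ {i} → Adj H x i → (near i ≡ C ⊎ i ≡ a) ⊎ i ≡ b
    neighbour {i} xi with near i in i∈
    ... | C = inj₁ (inj₁ refl)
    ... | L = ⊥-elim (irrefl H (subst (Adj H x) (decidable-stable (i ≟ x) λ i≢x → ¬∃ (i , i∈ , i≢x)) xi))
    ... | R with meet≡R (flip (σ i)) _ i∈
    ...   | inj₁ i∈L = inj₁ (inj₂ (proj₁ (σ-only (sym H xi) (flip-swap i∈L) x∈R)))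
    ...   | inj₂ i∈R = inj₂ (proj₂ (τ-only xi x∈L i∈R))

    deg≤ : # (adj? H x) ≤ 2 + # (on near C)
    deg≤ = ≤-trans
      (#-insert (adj? H x) (λ i → on near C i ⊎-dec i ≟ a) b neighbour)
      (s≤s (#-insert (λ i → on near C i ⊎-dec i ≟ a) (on near C) a id))

  -- An edge leaving this corner crosses one of the cuts, so it ends in `x`; but then it crosses the
  -- other cut as well, and its end in the corner is both `a` and `b`.
  far-separates : Separates far H
  far-separates {p} {q} pq p∈ q∈ with meet≡L (σ p) _ p∈ | meet≡R (σ q) _ q∈
  ... | p∈L , p∈R | inj₁ q∈R with σ-only pq p∈L q∈R
  ...   | refl , refl = a≢b (proj₂ (τ-only (sym H pq) x∈L (flip-swap p∈R)))
  far-separates {p} {q} pq p∈ q∈ | p∈L , p∈R | inj₂ q∈L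
    with τ-only (sym H pq) (flip-swap q∈L) (flip-swap p∈R)
  ...   | refl , refl = a≢b (≡.sym (proj₁ (σ-only pq p∈L x∈R)))

  far-boundary : ∀ {y} → far y ≡ L → k ≤ # (on far C)
  far-boundary {y} y∈L = ≮⇒≥ λ small → connected⇒¬cut {H = H} conn (cut far small far-separates {y} {x} y∈L x∈farR)
    where
    x∈farR : far x ≡ R
    x∈farR rewrite x∈R = refl

  submodular : # (on near C) + # (on far C) ≤ # (on σ C) + # (on τ C)
  submodular = #-modular (on near C) (on far C) (on σ C) (on τ C)
    (λ {i} → Sum.map₁ flip-swap ∘ meet≡C (flip (σ i)) (τ i))
    (λ {i} → Sum.map₂ flip-swap ∘ meet≡C (σ i) (flip (τ i)))
    (λ {i} → opposite-meets≡C (σ i) (τ i))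

  R-shrinks : # (on τ R) < # (on σ R)
  R-shrinks with any? (on far L)
  -- A nonempty far corner has a boundary of at least `k` vertices. The two separators have at most
  -- `k - 1` vertices each, so at most `k - 2` remain for the near boundary.
  ... | yes (y , y∈L) = ⊥-elim (near-boundary (+-cancelʳ-≤ k _ _ (begin
    2 + # (on near C) + k              ≤⟨ +-monoʳ-≤ (2 + # (on near C)) (far-boundary y∈L) ⟩
    2 + # (on near C) + # (on far C)   ≤⟨ +-monoʳ-≤ 2 submodular ⟩
    2 + (# (on σ C) + # (on τ C))      ≡⟨ cong suc (+-suc _ _) ⟨
    suc (# (on σ C)) + suc (# (on τ C)) ≤⟨ +-mono-≤ σ-small τ-small ⟩
    k + k                              ∎)))
    where open ≤-Reasoning
  ... | no ¬∃ with # (on near C) <? # (on σ C)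
  ...   | yes <σ = ⊥-elim (near-boundary (≤-trans (s≤s <σ) σ-small))
  -- As the far corner is empty, the `R` side of `τ` and the near boundary are disjoint and lie in
  -- the `R` side of `σ` without `x` together with the separator of `σ`. The near boundary is at
  -- least as large as that separator, so the `R` side of `τ` is no larger than the `R` side of `σ`
  -- without `x`.
  ...   | no ≮σ = begin
    suc (# (on τ R))  ≤⟨ s≤s (+-cancelʳ-≤ (# (on near C)) _ _ (≤-trans
                           (#-modular (on τ R) (on near C) rest? (on σ C) τR nearC (λ {i} → disjoint i))
                           (+-monoʳ-≤ _ (≮⇒≥ ≮σ)))) ⟩
    suc (# rest?)     ≤⟨ #-strict rest? (on σ R) proj₁ x∈R (λ (_ , x≢x) → x≢x refl) ⟩
    # (on σ R)        ∎
    where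
    open ≤-Reasoning
    rest? : Decidable (λ i → σ i ≡ R × i ≢ x)
    rest? i = on σ R i ×-dec ¬? (i ≟ x)

    ≢x : ∀ {i s} → τ i ≡ s → s ≢ L → i ≢ x
    ≢x i∈ s≢L refl = s≢L (trans (≡.sym i∈) x∈L)

    τR : ∀ {i} → τ i ≡ R → (σ i ≡ R × i ≢ x) ⊎ σ i ≡ C
    τR {i} i∈R with σ i in i∈
    ... | L = ⊥-elim (¬∃ (i , far≡L))
      where
      far≡L : far i ≡ L
      far≡L rewrite i∈ | i∈R = refl
    ... | C = inj₂ refl
    ... | R = inj₁ (refl , ≢x i∈R λ ())

    nearC : ∀ {i} → near i ≡ C → (σ i ≡ R × i ≢ x) ⊎ σ i ≡ C
    nearC {i} i∈ with σ i | τ i in i∈τ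
    ... | C | _ = inj₂ refl
    ... | R | C = inj₁ (refl , ≢x i∈τ λ ())
    nearC {i} () | L | _
    nearC {i} () | R | L
    nearC {i} () | R | R

    disjoint : ∀ i → τ i ≡ R → near i ≡ C → (σ i ≡ R × i ≢ x) × σ i ≡ C
    disjoint i i∈R i∈C = contradiction (trans (≡.sym i∈C) (meet-R (flip (σ i)) i∈R)) λ ()

-- By R-shrinks a walk along essential edges that never turns back stops.
module _ {H : Graph n} (conn : Connected[ k ] H) {W : Pred (Fin n) 0ℓ} (W? : Decidable W)
         (ess : ∀ {a b} → W a → W b → Adj H a b → EssentialCut k H a b)
         (k<deg : ∀ {x} → W x → k < # (adj? H x)) where

  private
    Leaf : Set
    Leaf = ∃[ w ] W w × # (λ i → W? i ×-dec adj? H w i) ≤ 1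

    follow : ∀ s {a x} → W a → W x → (E : EssentialCut k H a x) →
             # (on (EssentialCut.side E) R) ≤ s → Leaf
    follow s {a} {x} a∈W x∈W E ≤s with any? (λ b → W? b ×-dec adj? H x b ×-dec ¬? (b ≟ a))
    -- The walk is stuck at `x`, so `a` is the only possible neighbour of `x` in `W`.
    ... | no ¬∃ = x , x∈W , ≤-trans
            (#-mono (λ i → W? i ×-dec adj? H x i) (_≟ a)
              λ {i} (i∈W , xi) → decidable-stable (i ≟ a) λ i≢a → ¬∃ (i , i∈W , xi , i≢a))
            (≤-reflexive (#-singleton a))
    ... | yes (b , b∈W , xb , b≢a)
      with ess x∈W b∈W xb
    ...   | E′ with Crossing.R-shrinks conn (b≢a ∘ ≡.sym) (k<deg x∈W) E E′
    follow zero    _   _   E ≤s | yes _           | E′ | <R = contradiction (≤-trans <R ≤s) λ ()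
    follow (suc s) a∈W x∈W E ≤s | yes (_ , b∈W , _) | E′ | <R =
      follow s x∈W b∈W E′ (s≤s⁻¹ (≤-trans <R ≤s))

  leaf : ∀ {a} → W a → ∃[ w ] W w × # (λ i → W? i ×-dec adj? H w i) ≤ 1
  leaf {a} a∈W with any? (λ b → W? b ×-dec adj? H a b)
  ... | yes (b , b∈W , ab) = follow _ a∈W b∈W (ess a∈W b∈W ab) ≤-refl
  ... | no ¬∃ = a , a∈W , ≤-trans (≤-reflexive (#-∅ (λ i → W? i ×-dec adj? H a i) λ i → ¬∃ ∘ (i ,_))) z≤n

-- Matchings

module Matchings (G : Graph n) where

  IsEnd : Fin n → Edge G → Set
  IsEnd v e = end₁ {G = G} e ≡ v ⊎ end₂ {G = G} e ≡ v

  Covered : List (Edge G) → Fin n → Set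
  Covered M v = Any (IsEnd v) M

  covered? : ∀ M → Decidable (Covered M)
  covered? M v = Any.any? (λ e → (end₁ {G = G} e ≟ v) ⊎-dec (end₂ {G = G} e ≟ v)) M

  joins⇒end : ∀ {u v} e → Joins {G = G} u v e → IsEnd u e
  joins⇒end e (inj₁ (p , _)) = inj₁ p
  joins⇒end e (inj₂ (_ , q)) = inj₂ q

  joins⇒adj : ∀ {u v} e → Joins {G = G} u v e → Adj G u v
  joins⇒adj e (inj₁ (refl , refl)) = proj₂ e
  joins⇒adj e (inj₂ (refl , refl)) = sym G (proj₂ e)

  joined⇒covered : ∀ {M u v} → Any (Joins {G = G} u v) M → Covered M u
  joined⇒covered = Any.map (λ {e} → joins⇒end e)

  joins-unique : ∀ {u v w} e → Joins {G = G} u v e → Joins {G = G} u w e → v ≡ w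
  joins-unique e (inj₁ (refl , refl)) (inj₁ (refl , refl)) = refl
  joins-unique e (inj₁ (refl , refl)) (inj₂ (refl , refl)) = refl
  joins-unique e (inj₂ (refl , refl)) (inj₁ (refl , refl)) = refl
  joins-unique e (inj₂ (refl , refl)) (inj₂ (refl , refl)) = refl

  disjoint⇒≢ : ∀ {u v} e f → Disjoint {G = G} e f → IsEnd u e → IsEnd v f → u ≢ v
  disjoint⇒≢ e f (d , _)         (inj₁ refl) (inj₁ refl) = d
  disjoint⇒≢ e f (_ , d , _)     (inj₁ refl) (inj₂ refl) = d
  disjoint⇒≢ e f (_ , _ , d , _) (inj₂ refl) (inj₁ refl) = d
  disjoint⇒≢ e f (_ , _ , _ , d) (inj₂ refl) (inj₂ refl) = d

  disjoint-sym : ∀ {e f} → Disjoint {G = G} e f → Disjoint {G = G} f e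
  disjoint-sym (d₁ , d₂ , d₃ , d₄) = ≢-sym d₁ , ≢-sym d₃ , ≢-sym d₂ , ≢-sym d₄

  disjoint⇒uncovered : ∀ {v M} e → All (Disjoint {G = G} e) M → IsEnd v e → ¬ Covered M v
  disjoint⇒uncovered e (d ∷ ds) v∈e (here {f} v∈f) = disjoint⇒≢ e f d v∈e v∈f refl
  disjoint⇒uncovered e (d ∷ ds) v∈e (there v∈M)    = disjoint⇒uncovered e ds v∈e v∈M

  uncovered⇒disjoint : ∀ {M} e → (∀ {v} → IsEnd v e → ¬ Covered M v) → All (Disjoint {G = G} e) M
  uncovered⇒disjoint {[]}    e ∉M = []
  uncovered⇒disjoint {f ∷ M} e ∉M =
    ( (λ eq → ∉M (inj₁ refl) (here (inj₁ (≡.sym eq))))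
    , (λ eq → ∉M (inj₁ refl) (here (inj₂ (≡.sym eq))))
    , (λ eq → ∉M (inj₂ refl) (here (inj₁ (≡.sym eq))))
    , (λ eq → ∉M (inj₂ refl) (here (inj₂ (≡.sym eq)))))
    ∷ uncovered⇒disjoint e (λ v∈e → ∉M v∈e ∘ there)

  -- Shows that deleting a matching costs a vertex at most one neighbour. For an uncovered `v` the
  -- condition is vacuous, and `v` itself is the default.
  mate : ∀ {M} → AllPairs (Disjoint {G = G}) M → ∀ v → ∃[ w ] (∀ {q} → Any (Joins {G = G} v q) M → q ≡ w)
  mate {[]}    []       v = v , λ ()
  mate {e ∷ M} (d ∷ ds) v with end₁ {G = G} e ≟ v | end₂ {G = G} e ≟ v
  ... | yes refl | _ = end₂ {G = G} e , λ where
    (here j)  → joins-unique e j (inj₁ (refl , refl))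
    (there j) → ⊥-elim (disjoint⇒uncovered e d (inj₁ refl) (joined⇒covered j))
  ... | no _ | yes refl = end₁ {G = G} e , λ where
    (here j)  → joins-unique e j (inj₂ (refl , refl))
    (there j) → ⊥-elim (disjoint⇒uncovered e d (inj₂ refl) (joined⇒covered j))
  ... | no ≢₁ | no ≢₂ with mate ds v
  ...   | w , unique = w , λ where
    (here (inj₁ (eq , _))) → ⊥-elim (≢₁ eq)
    (here (inj₂ (_ , eq))) → ⊥-elim (≢₂ eq)
    (there j)              → unique j

  #-at : {P : Pred (Fin n) 0ℓ} (P? : Decidable P) (a : Fin n) →
         # (λ i → (a ≟ i) ×-dec P? i) ≤ ⟦ P? a ⟧
  #-at P? a with P? a
  ... | yes _ = ≤-trans (#-mono (λ i → (a ≟ i) ×-dec P? i) (_≟ a) (≡.sym ∘ proj₁)) (≤-reflexive (#-singleton a))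
  ... | no ¬p = ≤-reflexive (#-∅ (λ i → (a ≟ i) ×-dec P? i) λ { _ (refl , p) → ¬p p })

  #-covered : {P Q : Pred (Fin n) 0ℓ} (P? : Decidable P) (Q? : Decidable Q) (M : List (Edge G)) →
    All (λ e → (⟦ P? (end₁ {G = G} e) ⟧ + ⟦ P? (end₂ {G = G} e) ⟧) +
               (⟦ Q? (end₁ {G = G} e) ⟧ + ⟦ Q? (end₂ {G = G} e) ⟧) ≤ 2) M →
    # (λ i → covered? M i ×-dec P? i) + # (λ i → covered? M i ×-dec Q? i) ≤ length M + length M
  #-covered P? Q? [] [] = ≤-reflexive (cong₂ _+_
    (#-∅ (λ i → covered? [] i ×-dec P? i) (λ _ ())) (#-∅ (λ i → covered? [] i ×-dec Q? i) (λ _ ())))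
  #-covered P? Q? (e ∷ M) (≤2 ∷ ≤2s) = begin
    # (λ i → covered? (e ∷ M) i ×-dec P? i) + # (λ i → covered? (e ∷ M) i ×-dec Q? i)
      ≤⟨ +-mono-≤ (#-∷ P?) (#-∷ Q?) ⟩
    (at P? + rest P?) + (at Q? + rest Q?)
      ≡⟨ interchange +-commutativeSemigroup (at P?) (rest P?) (at Q?) (rest Q?) ⟩
    (at P? + at Q?) + (rest P? + rest Q?)
      ≤⟨ +-mono-≤ ≤2 (#-covered P? Q? M ≤2s) ⟩
    2 + (length M + length M)
      ≡⟨ cong suc (+-suc _ _) ⟨
    suc (length M) + suc (length M) ∎
    where
    open ≤-Reasoning
    a = end₁ {G = G} e
    b = end₂ {G = G} e

    at rest : {P : Pred (Fin n) 0ℓ} (P? : Decidable P) → ℕ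
    at P?   = ⟦ P? a ⟧ + ⟦ P? b ⟧
    rest P? = # (λ i → covered? M i ×-dec P? i)

    #-∷ : {P : Pred (Fin n) 0ℓ} (P? : Decidable P) → # (λ i → covered? (e ∷ M) i ×-dec P? i) ≤ at P? + rest P?
    #-∷ {P} P? = begin
      # (λ i → covered? (e ∷ M) i ×-dec P? i)
        ≤⟨ #-∪ (λ i → covered? (e ∷ M) i ×-dec P? i) ends? (λ i → covered? M i ×-dec P? i)
               (λ { (here i∈e , p) → inj₁ (Sum.map (_, p) (_, p) i∈e) ; (there i∈M , p) → inj₂ (i∈M , p) }) ⟩
      # ends? + rest P?
        ≤⟨ +-monoˡ-≤ _ (#-∪ ends? (λ i → (a ≟ i) ×-dec P? i) (λ i → (b ≟ i) ×-dec P? i) id) ⟩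
      (# (λ i → (a ≟ i) ×-dec P? i) + # (λ i → (b ≟ i) ×-dec P? i)) + rest P?
        ≤⟨ +-monoˡ-≤ _ (+-mono-≤ (#-at P? a) (#-at P? b)) ⟩
      at P? + rest P? ∎
      where
      ends? : Decidable (λ i → (a ≡ i × P i) ⊎ (b ≡ i × P i))
      ends? i = ((a ≟ i) ×-dec P? i) ⊎-dec ((b ≟ i) ×-dec P? i)

  #covered≤ : ∀ M → # (covered? M) ≤ length M + length M
  #covered≤ M = begin
    # (covered? M)
      ≤⟨ m≤m+n _ _ ⟩
    # (covered? M) + # (λ i → covered? M i ×-dec ∅? i)
      ≤⟨ +-monoˡ-≤ _ (#-mono (covered? M) (λ i → covered? M i ×-dec ⊤? i) (_, tt)) ⟩
    # (λ i → covered? M i ×-dec ⊤? i) + # (λ i → covered? M i ×-dec ∅? i)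
      ≤⟨ #-covered ⊤? ∅? M (All.universal (λ _ → ≤-refl) M) ⟩
    length M + length M ∎
    where open ≤-Reasoning

  -- Disjointness is symmetric, so the pairwise condition survives the reordering that brings the
  -- chosen edge to the front, where the exchange can drop it.
  extract : ∀ {M} {P : Edge G → Set} → AllPairs (Disjoint {G = G}) M → Any P M →
            ∃[ e ] P e × ∃[ M₀ ] M ↭ e ∷ M₀ × AllPairs (Disjoint {G = G}) (e ∷ M₀)
  extract ds any with find any
  ... | e , e∈M , p with ∈-∃++ e∈M
  ...   | xs , ys , refl = e , p , xs ++ ys , shift e xs ys ,
          Permutationₛ.AllPairs-resp-↭ (setoid (Edge G)) (λ {e} {f} → disjoint-sym {e} {f})
            (resp₂ (Disjoint {G = G})) (↭⇒↭ₛ (shift e xs ys)) ds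

-- Enlarging a matching

-- The number `d` bounds all degrees from below and will be the minimum degree. The bound `m+k<d`
-- will come from `2m ≤ d` and `2k < d`; `room` guarantees at least two uncovered vertices.
module Augment {n k} (1≤k : 1 ≤ k) (G : Graph n) (M : List (Edge G))
  (ds : AllPairs (Disjoint {G = G}) M) (conn : Connected[ k ] (G -ᴱ M))
  (d : ℕ) (d≤deg : ∀ v → d ≤ # (adj? G v)) (m+k<d : length M + k < d)
  (room : 2 + (length M + length M) ≤ n) where

  open Matchings G

  private
    m : ℕ
    m = length M

    H : Graph n
    H = G -ᴱ M

    V : Fin n → Set
    V = Covered M

    V? : Decidable V
    V? = covered? M

    U : Fin n → Set
    U v = ¬ V v

    U? : Decidable U
    U? v = ¬? (V? v)

    toH : ∀ {p q} → U p → Adj G p q → Adj H p q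
    toH p∈U pq = pq , p∈U ∘ joined⇒covered

    k<deg : ∀ {x} → U x → k < # (adj? H x)
    k<deg {x} x∈U = ≤-trans (s≤s (m≤n+m k m)) (≤-trans m+k<d (≤-trans (d≤deg x)
      (#-mono (adj? G x) (adj? H x) (toH x∈U))))

    -- The target of the counting arguments below: `m+k<d` gives `2m + 2k + 2 ≤ 2d`, so the
    -- hypothesis would force `k ≤ 0`.
    contradictory : d + d ≤ (m + m) + (k + 2) → ⊥
    contradictory ≤ = <⇒≱ 1≤k (+-cancelˡ-≤ ((m + m) + (k + 2)) _ _ (begin
      (m + m) + (k + 2) + k          ≡⟨ regroup m k ⟩
      suc (m + k) + suc (m + k)      ≤⟨ +-mono-≤ m+k<d m+k<d ⟩
      d + d                          ≤⟨ ≤ ⟩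
      (m + m) + (k + 2)              ≡⟨ +-identityʳ _ ⟨
      (m + m) + (k + 2) + 0          ∎))
      where
      open ≤-Reasoning
      regroup : ∀ m k → (m + m) + (k + 2) + k ≡ suc (m + k) + suc (m + k)
      regroup = solve-∀

    N? : ∀ v → Decidable (λ i → V i × Adj G v i)
    N? v i = V? i ×-dec adj? G v i

    common? : ∀ u v → Decidable (λ i → Adj G u i × Adj G v i)
    common? u v i = adj? G u i ×-dec adj? G v i

    N-overlap : ∀ u v → # (N? u) + # (N? v) ≤ (m + m) + # (common? u v)
    N-overlap u v = ≤-trans
      (#-modular (N? u) (N? v) V? (common? u v) (inj₁ ∘ proj₁) (inj₁ ∘ proj₁)
        λ (i∈V , ui) (_ , vi) → i∈V , ui , vi)
      (+-monoˡ-≤ _ (#covered≤ M))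

  Enlarged : Set
  Enlarged = Σ[ M′ ∈ List (Edge G) ]
    AllPairs (Disjoint {G = G}) M′ × length M′ ≡ suc m × Connected[ k ] (G -ᴱ M′)

  Essential : Set
  Essential = ∀ a b → U a → U b → Adj G a b → EssentialCut k H a b

  private
    module _ {a b : Fin n} (a∈U : U a) (b∈U : U b) (ab : Adj G a b) where
      e : Edge G
      e = (a , b) , ab

      crossing : ∀ {p q} (c : Cut k (G -ᴱ (e ∷ M))) → Adj H p q →
                 Cut.side c p ≡ L → Cut.side c q ≡ R → Joins {G = G} p q e
      crossing {p} {q} c (pq , ∉M) p∈L q∈R = decidable-stable (joins? {G = G} p q e) λ ¬j →
        Cut.separates c (pq , λ { (here j) → ¬j j ; (there ∈M) → ∉M ∈M }) p∈L q∈R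

      fromCut : (c : Cut k (G -ᴱ (e ∷ M))) → Cut.side c a ≡ L → Cut.side c b ≡ R →
                EssentialCut k H a b
      fromCut c a∈L b∈R = essential side small a∈L b∈R only
        where
        open Cut c
        only : ∀ {p q} → Adj H p q → side p ≡ L → side q ≡ R → p ≡ a × q ≡ b
        only pq p∈L q∈R with crossing c pq p∈L q∈R
        ... | inj₁ (refl , refl) = refl , refl
        ... | inj₂ (refl , refl) = contradiction (trans (≡.sym a∈L) q∈R) λ ()

      -- The new edge must cross the cut, since otherwise the same colouring would cut `H`; a flip
      -- puts `a` on the left if necessary.
      essentialCut : Cut k (G -ᴱ (e ∷ M)) → EssentialCut k H a b
      essentialCut c with on (Cut.side c) L a ×-dec on (Cut.side c) R b
                        | on (Cut.side c) R a ×-dec on (Cut.side c) L b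
      ... | yes (a∈L , b∈R) | _               = fromCut c a∈L b∈R
      ... | no _            | yes (a∈R , b∈L) = fromCut (flipCut c) (cong flip a∈R) (cong flip b∈L)
      ... | no ¬LR          | no ¬RL          =
        ⊥-elim (connected⇒¬cut {H = H} conn (cut side small separates′ left∈L right∈R))
        where
        open Cut c
        separates′ : Separates side H
        separates′ pq p∈L q∈R with crossing c pq p∈L q∈R
        ... | inj₁ (refl , refl) = ¬LR (p∈L , q∈R)
        ... | inj₂ (refl , refl) = ¬RL (q∈R , p∈L)

      add : Enlarged ⊎ EssentialCut k H a b
      add with cut⊎connected (G -ᴱ (e ∷ M)) (proj₁ conn)
      ... | inj₁ c     = inj₂ (essentialCut c)
      ... | inj₂ conn′ = inj₁ (e ∷ M ,
              uncovered⇒disjoint e (λ { (inj₁ refl) → a∈U ; (inj₂ refl) → b∈U }) ∷ ds , refl , conn′)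

  enlarged⊎essential : Enlarged ⊎ Essential
  enlarged⊎essential = all⊎ λ a → all⊎ λ b → decide a b
    where
    decide : ∀ a b → Enlarged ⊎ (U a → U b → Adj G a b → EssentialCut k H a b)
    decide a b with U? a ×-dec U? b ×-dec adj? G a b
    ... | yes (a∈U , b∈U , ab) = Sum.map₂ (λ E _ _ _ → E) (add a∈U b∈U ab)
    ... | no ¬edge = inj₂ λ a∈U b∈U ab → contradiction (a∈U , b∈U , ab) ¬edge

  module _ (ess : Essential) where

    private
      leafIn : {W : Pred (Fin n) 0ℓ} (W? : Decidable W) → (∀ {i} → W i → U i) → ∀ {a} → W a →
               ∃[ w ] W w × # (λ i → W? i ×-dec adj? H w i) ≤ 1
      leafIn W? W⊆U = leaf {H = H} conn W?
        (λ a∈W b∈W (ab , _) → ess _ _ (W⊆U a∈W) (W⊆U b∈W) ab) (k<deg ∘ W⊆U)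

    -- H′ plays the role of G − M′, where M′ = M − xy + ux + vy.
    module Exchange (H′ : Graph n) {u v x y : Fin n}
      (u-adj : ∀ {q} → Adj G u q → q ≢ x → Adj H′ u q)
      (v-adj : ∀ {q} → Adj G v q → q ≢ y → Adj H′ v q)
      (xy : Adj H′ x y)
      (U-adj : ∀ {w q} → U w → w ≢ u → w ≢ v → Adj G w q → Adj H′ w q)
      (lost : ∀ r → ∃[ w ] (∀ {q} → Adj G r q → q ≢ w → Adj H′ r q))
      (Nu : d ≤ suc (# (N? u))) (Nv : d ≤ suc (# (N? v)))
      {ρ : Fin n → Side} (small : # (on ρ C) < k) (sep : Separates ρ H′) (u∈L : ρ u ≡ L) where

      private
        ¬LR : ∀ {i} → ρ i ≡ L → ρ i ≡ R → ⊥
        ¬LR p q = contradiction (trans (≡.sym p) q) λ ()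

        y≢x : y ≢ x
        y≢x refl = irrefl H′ xy

        -- The paths u i v for a common neighbour i ∉ {x, y} and the path u y x v.
        common⊆C : ρ v ≡ R → ∃[ z ] (∀ {i} → Adj G u i × Adj G v i → ρ i ≡ C ⊎ i ≡ z)
        common⊆C v∈R with ρ x in x∈
        ... | C = y , common
          where
          common : ∀ {i} → Adj G u i × Adj G v i → ρ i ≡ C ⊎ i ≡ y
          common {i} (ui , vi) with i ≟ y | i ≟ x | ρ i in i∈
          ... | yes i≡y | _        | _ = inj₂ i≡y
          ... | no _    | yes refl | _ = inj₁ (trans (≡.sym i∈) x∈)
          ... | no i≢y  | no _     | L = ⊥-elim (sep (sym H′ (v-adj vi i≢y)) i∈ v∈R)
          ... | no _    | no _     | C = inj₁ refl
          ... | no _    | no i≢x   | R = ⊥-elim (sep (u-adj ui i≢x) u∈L i∈)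
        -- Here `x` is no common neighbour, because the edge `vx` would cross the cut.
        ... | L = y , common
          where
          common : ∀ {i} → Adj G u i × Adj G v i → ρ i ≡ C ⊎ i ≡ y
          common {i} (ui , vi) with i ≟ y | ρ i in i∈
          ... | yes i≡y | _ = inj₂ i≡y
          ... | no i≢y  | L = ⊥-elim (sep (sym H′ (v-adj vi i≢y)) i∈ v∈R)
          ... | no _    | C = inj₁ refl
          ... | no _    | R = ⊥-elim (sep (u-adj ui λ { refl → ¬LR x∈ i∈ }) u∈L i∈)
        -- Here a common neighbour `y` must lie in `C`: in `R` the edge `uy` would cross the cut, in
        -- `L` the edge `xy`.
        ... | R = x , common
          where
          common : ∀ {i} → Adj G u i × Adj G v i → ρ i ≡ C ⊎ i ≡ x
          common {i} (ui , vi) with i ≟ x | i ≟ y | ρ i in i∈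
          ... | yes i≡x | _        | _ = inj₂ i≡x
          ... | no _    | _        | C = inj₁ refl
          ... | no i≢x  | _        | R = ⊥-elim (sep (u-adj ui i≢x) u∈L i∈)
          ... | no _    | yes refl | L = ⊥-elim (sep (sym H′ xy) i∈ x∈)
          ... | no _    | no i≢y   | L = ⊥-elim (sep (sym H′ (v-adj vi i≢y)) i∈ v∈R)

        -- Otherwise `u` and `v` have at most `k` common neighbours, too few for two sets of at
        -- least `d - 1` covered neighbours among at most `2m` covered vertices.
        v∉R : ρ v ≢ R
        v∉R v∈R with common⊆C v∈R
        ... | z , common⊆ = contradictory (begin
          d + d                                ≤⟨ +-mono-≤ Nu Nv ⟩
          suc (# (N? u)) + suc (# (N? v))      ≡⟨ regroup (# (N? u)) (# (N? v)) ⟩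
          (# (N? u) + # (N? v)) + 2            ≤⟨ +-monoˡ-≤ 2 (N-overlap u v) ⟩
          (m + m) + # (common? u v) + 2        ≡⟨ +-assoc (m + m) _ 2 ⟩
          (m + m) + (# (common? u v) + 2)      ≤⟨ +-monoʳ-≤ (m + m) (+-monoˡ-≤ 2
                                                    (≤-trans (#-insert (common? u v) (on ρ C) z common⊆) small)) ⟩
          (m + m) + (k + 2)                    ∎)
          where
          open ≤-Reasoning
          regroup : ∀ a b → suc a + suc b ≡ (a + b) + 2
          regroup = solve-∀

        RV? : Decidable (λ i → ρ i ≡ R × V i)
        RV? i = on ρ R i ×-dec V? i

        RU? : Decidable (λ i → ρ i ≡ R × U i)
        RU? i = on ρ R i ×-dec U? i

        -- Of the covered vertices in R only x can be a neighbour of u.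
        #RV≤ : # RV? + d ≤ (m + m) + 2
        #RV≤ = begin
          # RV? + d                 ≤⟨ +-monoʳ-≤ (# RV?) Nu ⟩
          # RV? + suc (# (N? u))    ≡⟨ +-suc _ _ ⟩
          suc (# RV? + # (N? u))    ≤⟨ s≤s (#-modular RV? (N? u) V? (_≟ x) (inj₁ ∘ proj₂) (inj₁ ∘ proj₁) onlyx) ⟩
          suc (# V? + # (_≟ x))     ≡⟨ cong (λ s → suc (# V? + s)) (#-singleton x) ⟩
          suc (# V? + 1)            ≡⟨ +-suc _ 1 ⟨
          # V? + 2                  ≤⟨ +-monoˡ-≤ 2 (#covered≤ M) ⟩
          (m + m) + 2               ∎
          where
          open ≤-Reasoning
          onlyx : ∀ {i} → ρ i ≡ R × V i → V i × Adj G u i → V i × i ≡ x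
          onlyx {i} (i∈R , i∈V) (_ , ui) =
            i∈V , decidable-stable (i ≟ x) λ i≢x → sep (u-adj ui i≢x) u∈L i∈R

        -- The degree of `r` would be at most `1 + (2m + 2 - d) + (k - 1)`: one exceptional vertex
        -- in `W`, the covered vertices in `R`, and the separator.
        few-neighbours : ∀ {r} {W : Pred (Fin n) 0ℓ} (W? : Decidable W) → # W? ≤ 1 →
                         (∀ {i} → Adj G r i → W i ⊎ (ρ i ≡ R × V i) ⊎ ρ i ≡ C) → ⊥
        few-neighbours {r} W? #W≤1 nbr = contradictory (begin
          d + d                                            ≤⟨ +-monoʳ-≤ d (d≤deg r) ⟩
          d + # (adj? G r)                                 ≤⟨ +-monoʳ-≤ d (#-∪ (adj? G r) W? RV∪C? nbr) ⟩
          d + (# W? + # RV∪C?)                             ≤⟨ +-monoʳ-≤ d (+-mono-≤ #W≤1 (#-∪ RV∪C? RV? (on ρ C) id)) ⟩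
          d + suc (# RV? + # (on ρ C))                     ≡⟨ regroup d (# RV?) (# (on ρ C)) ⟩
          (# RV? + d) + suc (# (on ρ C))                   ≤⟨ +-mono-≤ #RV≤ small ⟩
          (m + m) + 2 + k                                  ≡⟨ +-assoc (m + m) 2 k ⟩
          (m + m) + (2 + k)                                ≡⟨ cong (m + m +_) (+-comm 2 k) ⟩
          (m + m) + (k + 2)                                ∎)
          where
          open ≤-Reasoning
          RV∪C? : Decidable (λ i → (ρ i ≡ R × V i) ⊎ ρ i ≡ C)
          RV∪C? i = RV? i ⊎-dec on ρ C i

          regroup : ∀ d a c → d + suc (a + c) ≡ (a + d) + suc c
          regroup = solve-∀

      -- If `R` has uncovered vertices, a leaf `w` among them has too few neighbours: it is neither
      -- `u` nor `v`, so it keeps all its edges in `H′`. If all of `R` is covered, `r` itself has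
      -- too few, the exception being the one neighbour it may have lost.
      absurd : ∀ {r} → ρ r ≡ R → ⊥
      absurd {r} r∈R with any? RU?
      ... | yes (_ , w₀∈) with leafIn RU? proj₂ w₀∈
      ...   | w , (w∈R , w∈U) , ≤1 =
        few-neighbours (λ i → RU? i ×-dec adj? H w i) ≤1 nbr
        where
        nbr : ∀ {i} → Adj G w i → ((ρ i ≡ R × U i) × Adj H w i) ⊎ (ρ i ≡ R × V i) ⊎ ρ i ≡ C
        nbr {i} wi with ρ i in i∈ | V? i
        ... | L | _       = ⊥-elim (sep (sym H′ (U-adj w∈U (λ { refl → ¬LR u∈L w∈R }) (λ { refl → v∉R w∈R }) wi)) i∈ w∈R)
        ... | C | _       = inj₂ (inj₂ refl)
        ... | R | yes i∈V = inj₂ (inj₁ (refl , i∈V))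
        ... | R | no i∈U  = inj₁ ((refl , i∈U) , toH w∈U wi)
      absurd {r} r∈R | no ∅ with lost r
      ... | w , kept = few-neighbours (_≟ w) (≤-reflexive (#-singleton w)) nbr
        where
        nbr : ∀ {i} → Adj G r i → i ≡ w ⊎ (ρ i ≡ R × V i) ⊎ ρ i ≡ C
        nbr {i} ri with i ≟ w | ρ i in i∈ | V? i
        ... | yes i≡w | _ | _       = inj₁ i≡w
        ... | no i≢w  | L | _       = ⊥-elim (sep (sym H′ (kept ri i≢w)) i∈ r∈R)
        ... | no _    | C | _       = inj₂ (inj₂ refl)
        ... | no _    | R | yes i∈V = inj₂ (inj₁ (refl , i∈V))
        ... | no _    | R | no i∈U  = ⊥-elim (∅ (i , i∈ , i∈U))

    module Swap {u v x y : Fin n} (u∈U : U u) (v∈U : U v) (u≢v : u ≢ v)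
      (ux : Adj G u x) (vy : Adj G v y)
      (Nu : d ≤ suc (# (N? u))) (Nv : d ≤ suc (# (N? v)))
      {e : Edge G} {M₀ : List (Edge G)} (xy : Joins {G = G} x y e)
      (M↭ : M ↭ e ∷ M₀) (ds₀ : AllPairs (Disjoint {G = G}) (e ∷ M₀)) where

      private
        M′ : List (Edge G)
        M′ = ((u , x) , ux) ∷ ((v , y) , vy) ∷ M₀

        H′ : Graph n
        H′ = G -ᴱ M′

        e⇒V : ∀ {i} → IsEnd i e → V i
        e⇒V i∈e = Any-resp-↭ (↭-sym M↭) (here i∈e)

        M₀⇒V : ∀ {i} → Covered M₀ i → V i
        M₀⇒V i∈M₀ = Any-resp-↭ (↭-sym M↭) (there i∈M₀)

        x∈e : IsEnd x e
        x∈e = joins⇒end e xy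

        y∈e : IsEnd y e
        y∈e = joins⇒end e (Sum.swap xy)

        e∉M₀ : ∀ {i} → IsEnd i e → ¬ Covered M₀ i
        e∉M₀ = disjoint⇒uncovered e (AllPairs.head ds₀)

        U≢e : ∀ {i j} → U i → IsEnd j e → i ≢ j
        U≢e i∈U j∈e refl = i∈U (e⇒V j∈e)

        Gxy : Adj G x y
        Gxy = joins⇒adj e xy

        x≢y : x ≢ y
        x≢y refl = irrefl G Gxy

        ds′ : AllPairs (Disjoint {G = G}) M′
        ds′ = ((u≢v , U≢e u∈U y∈e , ≢-sym (U≢e v∈U x∈e) , x≢y)
                ∷ uncovered⇒disjoint ((u , x) , ux) λ { (inj₁ refl) → u∈U ∘ M₀⇒V ; (inj₂ refl) → e∉M₀ x∈e })
            ∷ uncovered⇒disjoint ((v , y) , vy) (λ { (inj₁ refl) → v∈U ∘ M₀⇒V ; (inj₂ refl) → e∉M₀ y∈e })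
            ∷ AllPairs.tail ds₀

        u-adj : ∀ {q} → Adj G u q → q ≢ x → Adj H′ u q
        u-adj uq q≢x = uq , λ where
          (here (inj₁ (_ , eq)))          → q≢x (≡.sym eq)
          (here (inj₂ (_ , eq)))          → U≢e u∈U x∈e (≡.sym eq)
          (there (here (inj₁ (eq , _))))  → u≢v (≡.sym eq)
          (there (here (inj₂ (_ , eq))))  → U≢e u∈U y∈e (≡.sym eq)
          (there (there j))               → u∈U (M₀⇒V (joined⇒covered j))

        v-adj : ∀ {q} → Adj G v q → q ≢ y → Adj H′ v q
        v-adj vq q≢y = vq , λ where
          (here (inj₁ (eq , _)))          → u≢v eq
          (here (inj₂ (_ , eq)))          → U≢e v∈U x∈e (≡.sym eq)
          (there (here (inj₁ (_ , eq))))  → q≢y (≡.sym eq)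
          (there (here (inj₂ (_ , eq))))  → U≢e v∈U y∈e (≡.sym eq)
          (there (there j))               → v∈U (M₀⇒V (joined⇒covered j))

        H′xy : Adj H′ x y
        H′xy = Gxy , λ where
          (here (inj₁ (eq , _)))          → U≢e u∈U x∈e eq
          (here (inj₂ (eq , _)))          → U≢e u∈U y∈e eq
          (there (here (inj₁ (eq , _))))  → U≢e v∈U x∈e eq
          (there (here (inj₂ (eq , _))))  → U≢e v∈U y∈e eq
          (there (there j))               → e∉M₀ x∈e (joined⇒covered j)

        U-adj : ∀ {w q} → U w → w ≢ u → w ≢ v → Adj G w q → Adj H′ w q
        U-adj w∈U w≢u w≢v wq = wq , λ where
          (here (inj₁ (eq , _)))          → w≢u (≡.sym eq)
          (here (inj₂ (_ , eq)))          → U≢e w∈U x∈e (≡.sym eq)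
          (there (here (inj₁ (eq , _))))  → w≢v (≡.sym eq)
          (there (here (inj₂ (_ , eq))))  → U≢e w∈U y∈e (≡.sym eq)
          (there (there j))               → w∈U (M₀⇒V (joined⇒covered j))

        lost : ∀ r → ∃[ w ] (∀ {q} → Adj G r q → q ≢ w → Adj H′ r q)
        lost r with mate ds′ r
        ... | w , unique = w , λ rq q≢w → rq , q≢w ∘ unique

        H-adj : ∀ {p q} → Adj H p q → p ≢ u → q ≢ u → p ≢ v → q ≢ v → Adj H′ p q
        H-adj (pq , ∉M) p≢u q≢u p≢v q≢v = pq , λ where
          (here (inj₁ (eq , _)))          → p≢u (≡.sym eq)
          (here (inj₂ (eq , _)))          → q≢u (≡.sym eq)
          (there (here (inj₁ (eq , _))))  → p≢v (≡.sym eq)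
          (there (here (inj₂ (eq , _))))  → q≢v (≡.sym eq)
          (there (there j))               → ∉M (Any-resp-↭ (↭-sym M↭) (there j))

        -- The situation is symmetric under exchanging `u` with `v` and `x` with `y`, so one
        -- argument serves cuts with `u` outside the separator and those with `v` outside it.
        module Fromu = Exchange H′ u-adj v-adj H′xy U-adj lost Nu Nv
        module Fromv = Exchange H′ v-adj u-adj (sym H′ H′xy) (λ w∈U w≢v w≢u → U-adj w∈U w≢u w≢v) lost Nv Nu

        uncut : ¬ Cut k H′
        uncut c with Cut.side c u in u∈ | Cut.side c v in v∈
        ... | L | _ = Fromu.absurd (Cut.small c) (Cut.separates c) u∈ (Cut.right∈R c)
        ... | R | _ = Fromu.absurd (Cut.small c′) (Cut.separates c′) (cong flip u∈) (Cut.right∈R c′)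
          where c′ = flipCut c
        ... | C | L = Fromv.absurd (Cut.small c) (Cut.separates c) v∈ (Cut.right∈R c)
        ... | C | R = Fromv.absurd (Cut.small c′) (Cut.separates c′) (cong flip v∈) (Cut.right∈R c′)
          where c′ = flipCut c
        ... | C | C = connected⇒¬cut {H = H} conn (cut side small separates′ left∈L right∈R)
          where
          open Cut c
          ≢C : ∀ {i j s} → side i ≡ s → s ≢ C → side j ≡ C → i ≢ j
          ≢C i∈ s≢C j∈C refl = s≢C (trans (≡.sym i∈) j∈C)

          separates′ : Separates side H
          separates′ pq p∈L q∈R = separates
            (H-adj pq (≢C p∈L (λ ()) u∈) (≢C q∈R (λ ()) u∈) (≢C p∈L (λ ()) v∈) (≢C q∈R (λ ()) v∈))
            p∈L q∈R

      enlarged : Enlarged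
      enlarged with cut⊎connected H′ (proj₁ conn)
      ... | inj₁ c     = ⊥-elim (uncut c)
      ... | inj₂ conn′ = M′ , ds′ , cong suc (≡.sym (↭-length M↭)) , conn′

    private
      covered-degree : ∀ {w} {W : Pred (Fin n) 0ℓ} (W? : Decidable W) → U w →
                       (∀ {i} → U i → Adj G w i → W i) →
                       # (λ i → W? i ×-dec adj? H w i) ≤ 1 → d ≤ suc (# (N? w))
      covered-degree {w} W? w∈U U⊆W ≤1 = begin
        d                                             ≤⟨ d≤deg w ⟩
        # (adj? G w)                                  ≤⟨ #-∪ (adj? G w) (λ i → W? i ×-dec adj? H w i) (N? w) split ⟩
        # (λ i → W? i ×-dec adj? H w i) + # (N? w)    ≤⟨ +-monoˡ-≤ _ ≤1 ⟩
        suc (# (N? w))                                ∎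
        where
        open ≤-Reasoning
        split : ∀ {i} → Adj G w i → _ ⊎ (V i × Adj G w i)
        split {i} wi with V? i
        ... | yes i∈V = inj₂ (i∈V , wi)
        ... | no i∈U  = inj₁ (U⊆W i∈U wi , toH w∈U wi)

      -- A common neighbour on either side would provide a second edge across the essential cut, so
      -- all of them lie in its separator.
      common≤ : ∀ {u v} → U u → U v → Adj G u v → # (common? u v) < k
      common≤ {u} {v} u∈U v∈U uv = ≤-<-trans (#-mono (common? u v) (on side C) between) small
        where
        open EssentialCut (ess u v u∈U v∈U uv)
        between : ∀ {i} → Adj G u i × Adj G v i → side i ≡ C
        between {i} (ui , vi) with side i in i∈
        ... | L with only (sym H (toH v∈U vi)) i∈ b∈R
        ...   | refl , _ = ⊥-elim (irrefl G ui)
        between {i} (ui , vi) | C = refl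
        between {i} (ui , vi) | R with only (toH u∈U ui) a∈L i∈
        ...   | _ , refl = ⊥-elim (irrefl G vi)

      Swappable : Fin n → Fin n → Edge G → Set
      Swappable u v e = (Adj G u (end₁ {G = G} e) × Adj G v (end₂ {G = G} e))
                      ⊎ (Adj G u (end₂ {G = G} e) × Adj G v (end₁ {G = G} e))

      swappable? : ∀ u v → Decidable (Swappable u v)
      swappable? u v e = (adj? G u (end₁ {G = G} e) ×-dec adj? G v (end₂ {G = G} e))
                   ⊎-dec (adj? G u (end₂ {G = G} e) ×-dec adj? G v (end₁ {G = G} e))

      -- The four possible adjacencies form two pairs, each of which would allow a swap, so each
      -- pair contributes at most one. Only the joint count for `u` and `v` is bounded this way;
      -- this is why the edges of `M` are summed for two predicates at once.
      unswappable≤2 : ∀ u v e → ¬ Swappable u v e →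
        (⟦ adj? G u (end₁ {G = G} e) ⟧ + ⟦ adj? G u (end₂ {G = G} e) ⟧) +
        (⟦ adj? G v (end₁ {G = G} e) ⟧ + ⟦ adj? G v (end₂ {G = G} e) ⟧) ≤ 2
      unswappable≤2 u v e ¬s with adj? G u (end₁ {G = G} e) | adj? G u (end₂ {G = G} e)
                                | adj? G v (end₁ {G = G} e) | adj? G v (end₂ {G = G} e)
      ... | yes u₁ | _      | _      | yes v₂ = ⊥-elim (¬s (inj₁ (u₁ , v₂)))
      ... | _      | yes u₂ | yes v₁ | _      = ⊥-elim (¬s (inj₂ (u₂ , v₁)))
      ... | yes _  | yes _  | no _   | no _   = ≤-refl
      ... | yes _  | no _   | yes _  | no _   = ≤-refl
      ... | yes _  | no _   | no _   | no _   = s≤s z≤n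
      ... | no _   | yes _  | no _   | yes _  = ≤-refl
      ... | no _   | yes _  | no _   | no _   = s≤s z≤n
      ... | no _   | no _   | yes _  | yes _  = ≤-refl
      ... | no _   | no _   | yes _  | no _   = s≤s z≤n
      ... | no _   | no _   | no _   | yes _  = s≤s z≤n
      ... | no _   | no _   | no _   | no _   = z≤n

      swap : ∀ {u v} → U u → U v → u ≢ v → d ≤ suc (# (N? u)) → d ≤ suc (# (N? v)) → Enlarged
      swap {u} {v} u∈U v∈U u≢v Nu Nv with Any.any? (swappable? u v) M
      ... | no ¬∃ = ⊥-elim (contradictory (begin
        d + d                              ≤⟨ +-mono-≤ Nu Nv ⟩
        suc (# (N? u)) + suc (# (N? v))    ≡⟨ cong suc (+-suc _ _) ⟩
        2 + (# (N? u) + # (N? v))          ≤⟨ +-monoʳ-≤ 2 (#-covered (adj? G u) (adj? G v) M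
                                                (All.map (λ {e} → unswappable≤2 u v e) (¬Any⇒All¬ M ¬∃))) ⟩
        2 + (m + m)                        ≡⟨ +-comm 2 _ ⟩
        (m + m) + 2                        ≤⟨ +-monoʳ-≤ (m + m) (m≤n+m 2 k) ⟩
        (m + m) + (k + 2)                  ∎))
        where open ≤-Reasoning
      ... | yes ∃ with extract ds ∃
      ...   | e , inj₁ (ux , vy) , M₀ , M↭ , ds₀ =
        Swap.enlarged u∈U v∈U u≢v ux vy Nu Nv {e} (inj₁ (refl , refl)) M↭ ds₀
      ...   | e , inj₂ (ux , vy) , M₀ , M↭ , ds₀ =
        Swap.enlarged u∈U v∈U u≢v ux vy Nu Nv {e} (inj₂ (refl , refl)) M↭ ds₀

    essential⇒enlarged : Enlarged
    essential⇒enlarged with any? U?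
    ... | no ∅ = ⊥-elim (<⇒≱ room (begin
      n               ≡⟨ #-⊤ V? (λ i → decidable-stable (V? i) λ i∈U → ∅ (i , i∈U)) ⟨
      # V?            ≤⟨ #covered≤ M ⟩
      m + m           ≤⟨ n≤1+n _ ⟩
      suc (m + m)     ∎))
      where open ≤-Reasoning
    ... | yes (_ , i∈U) with leafIn U? id i∈U
    ...   | u , u∈U , #u≤1 with any? (λ i → U? i ×-dec ¬? (i ≟ u))
    ...     | no ∅ = ⊥-elim (<⇒≱ room (begin
      n               ≡⟨ #-⊤ (λ i → V? i ⊎-dec (i ≟ u)) all ⟨
      # (λ i → V? i ⊎-dec (i ≟ u)) ≤⟨ #-insert (λ i → V? i ⊎-dec (i ≟ u)) V? u id ⟩
      suc (# V?)      ≤⟨ s≤s (#covered≤ M) ⟩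
      suc (m + m)     ∎))
      where
      open ≤-Reasoning
      all : ∀ i → V i ⊎ i ≡ u
      all i with V? i
      ... | yes i∈V = inj₁ i∈V
      ... | no i∈U′ = inj₂ (decidable-stable (i ≟ u) λ i≢u → ∅ (i , i∈U′ , i≢u))
    ...     | yes (_ , i∈U∖u) with leafIn (λ i → U? i ×-dec ¬? (i ≟ u)) proj₁ i∈U∖u
    ...       | v , (v∈U , v≢u) , #v≤1 = swap u∈U v∈U (v≢u ∘ ≡.sym) Nu
      (covered-degree (λ i → U? i ×-dec ¬? (i ≟ u)) v∈U (λ { i∈U′ vi → i∈U′ , λ { refl → u≁v (sym G vi) } }) #v≤1)
      where
      open ≤-Reasoning
      Nu : d ≤ suc (# (N? u))
      Nu = covered-degree U? u∈U (λ i∈U′ _ → i∈U′) #u≤1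

      -- One weaker than what `swap` asks for, since the leaf `v` of `U` without `u` might also be
      -- adjacent to `u`. It suffices to exclude that adjacency, after which the sharper bound
      -- follows.
      Nv : d ≤ 2 + # (N? v)
      Nv = begin
        d                     ≤⟨ d≤deg v ⟩
        # (adj? G v)          ≤⟨ #-∪ (adj? G v) U∩v? (N? v) split ⟩
        # U∩v? + # (N? v)     ≤⟨ +-monoˡ-≤ _ (≤-trans (#-insert U∩v? (λ i → (U? i ×-dec ¬? (i ≟ u)) ×-dec adj? H v i) u split′) (s≤s #v≤1)) ⟩
        2 + # (N? v)          ∎
        where
        U∩v? : Decidable (λ i → U i × Adj G v i)
        U∩v? i = U? i ×-dec adj? G v i
        split : ∀ {i} → Adj G v i → (U i × Adj G v i) ⊎ (V i × Adj G v i)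
        split {i} vi with V? i
        ... | yes i∈V = inj₂ (i∈V , vi)
        ... | no i∈U′ = inj₁ (i∈U′ , vi)
        split′ : ∀ {i} → U i × Adj G v i → ((U i × i ≢ u) × Adj H v i) ⊎ i ≡ u
        split′ {i} (i∈U′ , vi) with i ≟ u
        ... | yes i≡u = inj₂ i≡u
        ... | no i≢u  = inj₁ ((i∈U′ , i≢u) , toH v∈U vi)

      -- The ends of an essential edge have fewer than k common neighbours.
      u≁v : ¬ Adj G u v
      u≁v uv = contradictory (begin
        d + d                                     ≤⟨ +-mono-≤ Nu Nv ⟩
        suc (# (N? u)) + (2 + # (N? v))           ≡⟨ regroup (# (N? u)) (# (N? v)) ⟩
        (# (N? u) + # (N? v)) + 3                 ≤⟨ +-monoˡ-≤ 3 (N-overlap u v) ⟩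
        (m + m) + # (common? u v) + 3             ≡⟨ regroup′ (m + m) (# (common? u v)) ⟩
        (m + m) + (suc (# (common? u v)) + 2)     ≤⟨ +-monoʳ-≤ (m + m) (+-monoˡ-≤ 2 (common≤ u∈U v∈U uv)) ⟩
        (m + m) + (k + 2)                         ∎)
        where
        regroup : ∀ a b → suc a + (2 + b) ≡ (a + b) + 3
        regroup = solve-∀
        regroup′ : ∀ a b → a + b + 3 ≡ a + (suc b + 2)
        regroup′ = solve-∀

  enlarge : Enlarged
  enlarge = [ id , essential⇒enlarged ]′ enlarged⊎essential

-- Complete graphs and the induction on the size of the matching

complete⇒≅K : ∀ {n p} {G : Graph n} → n ≡ p → (∀ {u v} → u ≢ v → Adj G u v) → G ≅ K p
complete⇒≅K {G = G} refl complete =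
  ↔-id _ , λ u v → mk⇔ (λ { uv refl → irrefl G uv }) complete

δ≤# : (G : Graph n) (v : Fin n) → δ G ≤ # (adj? G v)
δ≤# {n} G v = ≤-trans
  (All.lookup (min≤xs n (map (degree G) (allFin n))) (∈-map⁺ (degree G) (∈-allFin v)))
  (≤-reflexive (degree≡# G v))

#adj<n : (G : Graph n) (v : Fin n) → # (adj? G v) < n
#adj<n {n} G v = ≤-trans
  (#-strict (adj? G v) ⊤? (λ _ → tt) tt (irrefl G))
  (≤-reflexive (#-⊤ {n} ⊤? (λ _ → tt)))

-- A vertex `u` with a non-neighbour `v` misses both itself and `v`, so its degree is at most
-- `n - 2`.
complete : (G : Graph n) → n ≤ suc (δ G) → ∀ {u v} → u ≢ v → Adj G u v
complete {n} G n≤ {u} {v} u≢v = decidable-stable (adj? G u v) λ ¬uv → <⇒≱ (begin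
  2 + δ G                     ≤⟨ s≤s (s≤s (δ≤# G u)) ⟩
  2 + # (adj? G u)            ≤⟨ s≤s (#-strict (adj? G u) ≢u? (λ { uu refl → irrefl G uu }) (u≢v ∘ ≡.sym) ¬uv) ⟩
  suc (# ≢u?)                 ≤⟨ #-strict ≢u? ⊤? (λ _ → tt) tt (λ u≢u → u≢u refl) ⟩
  # {n} ⊤?        ≡⟨ #-⊤ {n} ⊤? (λ _ → tt) ⟩
  n                           ∎) n≤
  where
  open ≤-Reasoning
  ≢u? : Decidable (_≢ u)
  ≢u? i = ¬? (i ≟ u)

-- The ceiling of `(d + 1) / 2` is by definition the floor of `(d + 2) / 2`, so twice it is at most
-- `d + 2`.
double≤ : ∀ {ℓ d} → ℓ < ⌈ d + 1 /2⌉ → ℓ + ℓ ≤ d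
double≤ {ℓ} {d} ℓ< = +-cancelˡ-≤ 2 _ _ (begin
  2 + (ℓ + ℓ)                            ≡⟨ cong suc (+-suc ℓ ℓ) ⟨
  suc ℓ + suc ℓ                          ≤⟨ +-mono-≤ ℓ< ℓ< ⟩
  ⌊ N /2⌋ + ⌊ N /2⌋                      ≤⟨ +-monoʳ-≤ _ (⌊n/2⌋≤⌈n/2⌉ N) ⟩
  ⌊ N /2⌋ + ⌈ N /2⌉                      ≡⟨ ⌊n/2⌋+⌈n/2⌉≡n N ⟩
  suc (d + 1)                            ≡⟨ cong suc (+-comm d 1) ⟩
  2 + d                                  ∎)
  where
  open ≤-Reasoning
  N = suc (d + 1)

corollary1p8 : ∀ (k : ℕ) → 1 ≤ k →
    ∀ {n : ℕ} (G : Graph n) →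
    Connected[ k ] G →
    2 * k + 1 ≤ δ G →
    ¬ (2 ∣ δ G × G ≅ K (δ G + 1)) →
    Σ[ M ∈ List (Edge G) ] (Matching[ ⌈ δ G + 1 /2⌉ ] G M × Removable[ k ] G M)
corollary1p8 k 1≤k {n} G (k<n , conn) 2k<δ exception = build ⌈ d + 1 /2⌉ ≤-refl
  where
  d = δ G

  d<n : d < n
  d<n = ≤-<-trans (δ≤# G v) (#adj<n G v)
    where v = fromℕ< k<n

  module _ {m : ℕ} (2m≤d : m + m ≤ d) where

    m+k<d : m + k < d
    m+k<d = ≰⇒> λ d≤ → <⇒≱ (begin
      suc ((m + k) + (m + k))    ≡⟨ regroup m k ⟩
      (m + m) + (2 * k + 1)      ≤⟨ +-mono-≤ 2m≤d 2k<δ ⟩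
      d + d                      ∎) (+-mono-≤ d≤ d≤)
      where
      open ≤-Reasoning
      regroup : ∀ m k → suc ((m + k) + (m + k)) ≡ (m + m) + (2 * k + 1)
      regroup = solve-∀

    room : 2 + (m + m) ≤ n
    -- If `n ≤ 2m + 1`, then `2m ≤ d < n` forces `d = 2m` and `n = d + 1`, which is the excluded
    -- complete graph.
    room = ≰⇒> λ n≤ → exception
      ( divides m (trans (≤-antisym (s≤s⁻¹ (≤-trans d<n n≤)) 2m≤d) (double m))
      , complete⇒≅K {G = G}
          (trans (≤-antisym (≤-trans n≤ (s≤s 2m≤d)) d<n) (+-comm 1 d))
          (complete G (≤-trans n≤ (s≤s 2m≤d))))
      where
      double : ∀ m → m + m ≡ m * 2
      double = solve-∀

  build : ∀ ℓ → ℓ ≤ ⌈ d + 1 /2⌉ → Σ[ M ∈ List (Edge G) ] (Matching[ ℓ ] G M × Removable[ k ] G M)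
  build zero    _  = [] , ([] , refl) , k<n , λ S <k u v u∉S v∉S →
    Star.map (λ (x∉S , y∉S , xy) → x∉S , y∉S , xy , λ ()) (conn S <k u v u∉S v∉S)
  build (suc ℓ) ℓ< with build ℓ (<⇒≤ ℓ<)
  ... | M , (ds , refl) , connM with Augment.enlarge 1≤k G M ds connM d (δ≤# G)
                                                    (m+k<d {length M} (double≤ {length M} ℓ<)) (room {length M} (double≤ {length M} ℓ<))
  ...   | M′ , ds′ , ∣M′∣ , connM′ = M′ , (ds′ , ∣M′∣) , connM′
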